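{- Let $n = p_1p_2$ where $p_1 < p_2$ are odd primes. Then $$g(\Phi_n) = p_1 - 1.$$
   Context: $\Phi_n$ denotes the $n$-th cyclotomic polynomial, $\Phi_n(x) = \prod_{1\le j\le n,\ \gcd(j,n)=1}(x-\zeta_n^j)$, where $\zeta_n$ is a primitive $n$-th root of unity. Maximum gap: for a nonzero univariate polynomial $f = c_1x^{e_1}+\cdots+c_tx^{e_t}$ with $c_1,\ldots,c_t\neq 0$ and $e_1<\cdots<e_t$, the maximum gap of $f$ is $g(f) = \max_{1\le i<t}(e_{i+1}-e_i)$, with $g(f)=0$ when $t=1$. -}

module Defs where

open import Level using (_⊔_)
open import Algebra.Bundles using (CommutativeRing)
open import Algebra.Apartness.Bundles using (HeytingField; HeytingCommutativeRing)
open import Data.Nat as ℕ using (ℕ; zero; suc; _<_; _∸_)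
import Data.Nat.Properties as ℕ
open import Data.Nat.GCD using (gcd)
open import Data.List using (List; []; _∷_; _++_; [_]; map; foldr; filter; replicate; applyUpTo)
open import Data.List.Membership.Propositional using (_∈_; _∉_)
open import Data.List.Membership.DecPropositional ℕ._≟_ using (_∈?_)
open import Data.List.Relation.Unary.All as All using (All; []; _∷_)
open import Data.List.Relation.Unary.Any using (here; there)
open import Data.List.Relation.Unary.AllPairs using (AllPairs; []; _∷_)
open import Data.List.Relation.Unary.Linked using (Linked)
open import Data.List.Relation.Unary.Linked.Properties using (Linked⇒AllPairs)
open import Data.Product using (∃; ∃-syntax; _×_; _,_; proj₁; proj₂)
open import Data.Empty using (⊥-elim)
open import Function using (_∘_)
open import Relation.Binary.PropositionalEquality as ≡ using (_≡_; _≢_; cong₂)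
open import Relation.Nullary using (¬_; yes; no)

gaps : List ℕ → List ℕ
gaps (e ∷ es@(e′ ∷ _)) = (e′ ∸ e) ∷ gaps es
gaps _                 = []

-- The base value 0 of the maximum is the convention for a single exponent.
largestGap : List ℕ → ℕ
largestGap es = foldr ℕ._⊔_ 0 (gaps es)

module _ {c ℓ₁ ℓ₂} (K : HeytingField c ℓ₁ ℓ₂) where

  fieldRing : CommutativeRing c ℓ₁
  fieldRing = HeytingCommutativeRing.commutativeRing (HeytingField.heytingCommutativeRing K)

module _ {c ℓ} (R : CommutativeRing c ℓ) where

  open CommutativeRing R
  open import Algebra.Properties.Semiring.Exp semiring using (_^_)
  open import Algebra.Properties.Semiring.Mult semiring using () renaming (_×_ to _·_)

  CharacteristicZero : Set ℓ
  CharacteristicZero = ∀ m → 0 < m → m · 1# ≉ 0#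

  IsPrimitiveRootOfUnity : ℕ → Carrier → Set ℓ
  IsPrimitiveRootOfUnity n ζ = ζ ^ n ≈ 1# × (∀ k → 0 < k → k < n → ζ ^ k ≉ 1#)

  -- Coefficient lists, constant term first; trailing zeros are allowed, so
  -- polynomials are compared by _≈ₚ_.
  Poly : Set c
  Poly = List Carrier

  coeff : Poly → ℕ → Carrier
  coeff []      _       = 0#
  coeff (a ∷ _) zero    = a
  coeff (_ ∷ f) (suc k) = coeff f k

  infix 4 _≈ₚ_
  _≈ₚ_ : Poly → Poly → Set ℓ
  f ≈ₚ g = ∀ k → coeff f k ≈ coeff g k

  infixl 6 _+ₚ_
  _+ₚ_ : Poly → Poly → Poly
  []      +ₚ g       = g
  (a ∷ f) +ₚ []      = a ∷ f
  (a ∷ f) +ₚ (b ∷ g) = (a + b) ∷ (f +ₚ g)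

  -- (a + x f) g = a g + x (f g)
  infixl 7 _*ₚ_
  _*ₚ_ : Poly → Poly → Poly
  []      *ₚ g = []
  (a ∷ f) *ₚ g = map (a *_) g +ₚ (0# ∷ f *ₚ g)

  productₚ : List Poly → Poly
  productₚ = foldr _*ₚ_ [ 1# ]

  sumₚ : List Poly → Poly
  sumₚ = foldr _+ₚ_ []

  X-_ : Carrier → Poly
  X- a = (- a) ∷ 1# ∷ []

  monomial : Carrier → ℕ → Poly
  monomial a e = replicate e 0# ++ [ a ]

  totatives : ℕ → List ℕ
  totatives n = filter (λ j → gcd j n ℕ.≟ 1) (applyUpTo suc n)

  cyclotomic : ℕ → Carrier → Poly
  cyclotomic n ζ = productₚ (map (λ j → X- (ζ ^ j)) (totatives n))

  Term : Set c
  Term = Carrier × ℕ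

  record IsSparseForm (f : Poly) (ts : List Term) : Set (c ⊔ ℓ) where
    field
      nonzero    : All (λ t → proj₁ t ≉ 0#) ts
      increasing : Linked _<_ (map proj₂ ts)
      expansion  : f ≈ₚ sumₚ (map (λ (a , e) → monomial a e) ts)

  -- A relation rather than a function, as equality with 0# need not be decidable.
  -- A witness makes f nonzero; HasMaximumGap-unique shows that g is determined by f.
  HasMaximumGap : Poly → ℕ → Set (c ⊔ ℓ)
  HasMaximumGap f g =
    ∃[ ts ] ts ≢ [] × IsSparseForm f ts × largestGap (map proj₂ ts) ≡ g

  private
    ⟦_⟧ : List Term → Poly
    ⟦ ts ⟧ = sumₚ (map (λ (a , e) → monomial a e) ts)

    coeff-+ : ∀ f g k → coeff (f +ₚ g) k ≈ coeff f k + coeff g k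
    coeff-+ []      g       k       = sym (+-identityˡ _)
    coeff-+ (a ∷ f) []      k       = sym (+-identityʳ _)
    coeff-+ (a ∷ f) (b ∷ g) zero    = refl
    coeff-+ (a ∷ f) (b ∷ g) (suc k) = coeff-+ f g k

    coeff-monomial-≡ : ∀ a e → coeff (monomial a e) e ≈ a
    coeff-monomial-≡ a zero    = refl
    coeff-monomial-≡ a (suc e) = coeff-monomial-≡ a e

    coeff-monomial-≢ : ∀ a e k → k ≢ e → coeff (monomial a e) k ≈ 0#
    coeff-monomial-≢ a zero    zero    k≢e = ⊥-elim (k≢e ≡.refl)
    coeff-monomial-≢ a zero    (suc k) k≢e = refl
    coeff-monomial-≢ a (suc e) zero    k≢e = refl
    coeff-monomial-≢ a (suc e) (suc k) k≢e = coeff-monomial-≢ a e k (k≢e ∘ ≡.cong suc)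

    coeff-∉ : ∀ ts {k} → k ∉ map proj₂ ts → coeff ⟦ ts ⟧ k ≈ 0#
    coeff-∉ []             k∉ = refl
    coeff-∉ ((a , e) ∷ ts) {k} k∉ =
      trans (coeff-+ (monomial a e) ⟦ ts ⟧ k)
        (trans (+-cong (coeff-monomial-≢ a e k (k∉ ∘ here)) (coeff-∉ ts (k∉ ∘ there)))
               (+-identityˡ 0#))

    above⇒∉ : ∀ {e es} → All (e <_) es → e ∉ es
    above⇒∉ e<es e∈es = ℕ.<-irrefl ≡.refl (All.lookup e<es e∈es)

    coeff-∈ : ∀ ts {k} → All (λ t → proj₁ t ≉ 0#) ts → AllPairs _<_ (map proj₂ ts) →
              k ∈ map proj₂ ts → coeff ⟦ ts ⟧ k ≉ 0#
    coeff-∈ ((a , e) ∷ ts) (a≉0 ∷ _) (e<ts ∷ _) (here ≡.refl) k≈0 =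
      a≉0 (trans (sym (trans (coeff-+ (monomial a e) ⟦ ts ⟧ e)
                 (trans (+-cong (coeff-monomial-≡ a e) (coeff-∉ ts (above⇒∉ e<ts)))
                        (+-identityʳ a)))) k≈0)
    coeff-∈ ((a , e) ∷ ts) {k} (_ ∷ nz) (e<ts ∷ inc) (there k∈) k≈0 =
      coeff-∈ ts nz inc k∈
        (trans (sym (trans (coeff-+ (monomial a e) ⟦ ts ⟧ k)
               (trans (+-congʳ (coeff-monomial-≢ a e k k≢e)) (+-identityˡ _)))) k≈0)
      where
      k≢e : k ≢ e
      k≢e ≡.refl = above⇒∉ e<ts k∈

    sorted-unique : ∀ {es es′} → AllPairs _<_ es → AllPairs _<_ es′ →
                    (∀ {k} → k ∈ es → k ∈ es′) → (∀ {k} → k ∈ es′ → k ∈ es) → es ≡ es′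
    sorted-unique [] [] _ _ = ≡.refl
    sorted-unique [] (_ ∷ _) _ ⊇ with () ← ⊇ (here ≡.refl)
    sorted-unique (_ ∷ _) [] ⊆ _ with () ← ⊆ (here ≡.refl)
    sorted-unique {e ∷ es} {e′ ∷ es′} (e<es ∷ inc) (e′<es′ ∷ inc′) ⊆ ⊇ =
      cong₂ _∷_ e≡e′ (sorted-unique inc inc′ ⊆-tail ⊇-tail)
      where
      head≤ : ∀ {a k as} → All (a <_) as → k ∈ a ∷ as → a ℕ.≤ k
      head≤ _    (here ≡.refl) = ℕ.≤-refl
      head≤ a<as (there k∈)    = ℕ.<⇒≤ (All.lookup a<as k∈)

      e≡e′ : e ≡ e′
      e≡e′ = ℕ.≤-antisym (head≤ e<es (⊇ (here ≡.refl))) (head≤ e′<es′ (⊆ (here ≡.refl)))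

      ⊆-tail : ∀ {k} → k ∈ es → k ∈ es′
      ⊆-tail k∈ with ⊆ (there k∈)
      ... | here k≡e′ = ⊥-elim (above⇒∉ e<es (≡.subst (_∈ es) (≡.trans k≡e′ (≡.sym e≡e′)) k∈))
      ... | there k∈′ = k∈′

      ⊇-tail : ∀ {k} → k ∈ es′ → k ∈ es
      ⊇-tail k∈ with ⊇ (there k∈)
      ... | here k≡e  = ⊥-elim (above⇒∉ e′<es′ (≡.subst (_∈ es′) (≡.trans k≡e e≡e′) k∈))
      ... | there k∈′ = k∈′

    sparse-⊆ : ∀ {f ts ts′} → IsSparseForm f ts → IsSparseForm f ts′ →
               ∀ {k} → k ∈ map proj₂ ts → k ∈ map proj₂ ts′
    sparse-⊆ {ts = ts} {ts′} s s′ {k} k∈ with k ∈? map proj₂ ts′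
    ... | yes k∈′ = k∈′
    ... | no  k∉′ = ⊥-elim (coeff-∈ ts (nonzero s) (Linked⇒AllPairs ℕ.<-trans (increasing s)) k∈
                      (trans (sym (expansion s k)) (trans (expansion s′ k) (coeff-∉ ts′ k∉′))))
      where open IsSparseForm

  HasMaximumGap-unique : ∀ {f g g′} → HasMaximumGap f g → HasMaximumGap f g′ → g ≡ g′
  HasMaximumGap-unique (_ , _ , s , ≡.refl) (_ , _ , s′ , ≡.refl) =
    ≡.cong largestGap (sorted-unique (sorted s) (sorted s′) (sparse-⊆ s s′) (sparse-⊆ s′ s))
    where
    sorted : ∀ {f ts} → IsSparseForm f ts → AllPairs _<_ (map proj₂ ts)
    sorted = Linked⇒AllPairs ℕ.<-trans ∘ IsSparseForm.increasing

{-# OPTIONS --safe #-}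
-- The polynomial Φ_pq is (1 − X) Σ Xˢ, the sum being over the numerical semigroup
-- S = ⟨p,q⟩, truncated at degree c = (p−1)(q−1), above which everything lies in S.
-- Indeed the coefficients [k ∈ S] − [k−1 ∈ S] give a monic polynomial F of degree c,
-- and (1 − Xᵖ) Σ Xˢ = 1 + X^q + ⋯ + X^((p−1)q) makes F vanish at every primitive pq-th
-- root of unity; there are c of these, so F is their product.
-- The nonzero coefficients of F sit where membership in S changes. Since S + p ⊆ S,
-- a run of p consecutive non-elements cannot follow an element, and a run of p
-- consecutive elements never ends, so all gaps are at most p − 1. The gap p − 1
-- occurs between the exponents 1 and p, because 0, p ∈ S but 1, …, p−1 ∉ S.
module Submission where

open import Algebra.Apartness.Bundles using (HeytingField)
open import Algebra.Bundles using (CommutativeRing)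
open import Data.Bool using (Bool; true; false; if_then_else_)
open import Data.Bool.Properties using (¬-not) renaming (_≟_ to _≟ᵇ_)
open import Data.List using (List; []; _∷_; [_]; map; filter; length; applyUpTo; upTo)
open import Data.List.Properties using (map-∘; map-id; map-applyUpTo; length-map)
open import Data.List.Relation.Unary.All as All using (All; []; _∷_)
import Data.List.Relation.Unary.All.Properties as All
open import Data.List.Relation.Unary.AllPairs as AllPairs using (AllPairs; []; _∷_)
import Data.List.Relation.Unary.AllPairs.Properties as AllPairs
open import Data.List.Relation.Unary.Linked using (Linked)
open import Data.List.Relation.Unary.Linked.Properties using (AllPairs⇒Linked)
open import Data.Nat as ℕ using (ℕ; zero; suc; s≤s; z<s)
open import Data.Nat.Divisibility using (_∣_; _∣?_; divides; _∤_)
import Data.Nat.Divisibility as ℕ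
open import Data.Nat.DivMod using (_%_; _/_; m%n<n; m≡m%n+[m/n]*n)
open import Data.Nat.Primality using (Prime; prime⇒nonTrivial)
import Data.Nat.Properties as ℕ
open import Data.Product using (∃-syntax; _×_; _,_; proj₁; proj₂)
open import Data.Sum using (_⊎_; inj₁; inj₂)
open import Function using (_∘_; case_of_; id)
open import Level using (0ℓ)
open import Relation.Binary.PropositionalEquality as ≡ using (_≡_; _≢_)
open import Relation.Nullary using (¬_; Dec; does; proof; yes; no; ¬?; contradiction)
open import Relation.Nullary.Decidable using (dec-true; dec-false)

open import Defs hiding (X-_)
import Defs

-- Congruences and inverses modulo d.

module Arithmetic where

  open import Data.List using (_++_)
  open import Data.List.Membership.Propositional using (_∈_)
  open import Data.List.Membership.Propositional.Properties using (∈-filter⁺; ∈-filter⁻; ∈-upTo⁺; ∈-upTo⁻)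
  open import Data.List.Properties using
    (foldr-preservesᵇ; foldr-preservesᵒ; applyUpTo-∷ʳ; filter-++; length-++; filter-accept; filter-reject)
  open import Data.List.Relation.Unary.Any as Any using (here; there)
  open import Data.Nat
  open import Data.Nat.Coprimality using (Coprime; coprime-Bézout; coprime-divisor; coprime⇒gcd≡1; prime⇒coprime)
  open import Data.Nat.Divisibility
  open import Data.Nat.DivMod
  open import Data.Nat.GCD using (gcd; gcd-greatest; module Bézout)
  open import Data.Nat.Primality using (prime⇒irreducible; prime⇒nonZero; ¬prime[1])
  open import Data.Nat.Properties
  open import Data.Nat.Solver using (module +-*-Solver)
  open import Relation.Binary.PropositionalEquality
  open import Relation.Nullary.Reflects using (Reflects; invert)
  open import Relation.Unary using (Pred; Decidable)

  -- With equal remainders the order is decided by the quotients, so these differ by at least one.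
  ≡-mod⇒+≤ : ∀ {m n} d .{{_ : NonZero d}} → m % d ≡ n % d → m < n → m + d ≤ n
  ≡-mod⇒+≤ {m} {n} d m≡n m<n = begin
    m + d                       ≡⟨ cong (_+ d) (m≡m%n+[m/n]*n m d) ⟩
    m % d + m / d * d + d       ≡⟨ +-assoc (m % d) _ d ⟩
    m % d + (m / d * d + d)     ≡⟨ cong₂ _+_ m≡n (+-comm _ d) ⟩
    n % d + suc (m / d) * d     ≤⟨ +-monoʳ-≤ (n % d) (*-monoˡ-≤ d (≰⇒> n/d≰m/d)) ⟩
    n % d + n / d * d           ≡⟨ m≡m%n+[m/n]*n n d ⟨
    n                           ∎
    where
    open ≤-Reasoning
    n/d≰m/d : ¬ n / d ≤ m / d
    n/d≰m/d n/d≤m/d = <⇒≱ m<n (begin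
      n                  ≡⟨ m≡m%n+[m/n]*n n d ⟩
      n % d + n / d * d  ≤⟨ +-mono-≤ (≤-reflexive (sym m≡n)) (*-monoˡ-≤ d n/d≤m/d) ⟩
      m % d + m / d * d  ≡⟨ m≡m%n+[m/n]*n m d ⟨
      m                  ∎)

  coprime⇒invertible : ∀ {d n} .{{_ : NonZero d}} → Coprime n d → ∃[ x ] (x * n) % d ≡ 1 % d
  coprime⇒invertible {d} {n} n⊥d with coprime-Bézout n⊥d
  ... | Bézout.+- x y eq = x , trans (%-congˡ {o = d} (sym eq)) ([m+kn]%n≡m%n 1 y d)
  -- Here 1 + x n = y d, so -x inverts n; `pred d` stands for -1 modulo d.
  ... | Bézout.-+ x y eq = x * pred d , (begin
      (x * pred d * n) % d                ≡⟨ [m+kn]%n≡m%n (x * pred d * n) y d ⟨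
      (x * pred d * n + y * d) % d        ≡⟨ %-congˡ {o = d} (cong (x * pred d * n +_) (sym eq)) ⟩
      (x * pred d * n + (1 + x * n)) % d  ≡⟨ %-congˡ {o = d} (solve 3 (λ x d′ n →
         x :* d′ :* n :+ (con 1 :+ x :* n) := con 1 :+ x :* n :* (con 1 :+ d′)) refl x (pred d) n) ⟩
      (1 + x * n * suc (pred d)) % d      ≡⟨ %-congˡ {o = d} (cong (λ d → 1 + x * n * d) (suc-pred d)) ⟩
      (1 + x * n * d) % d                 ≡⟨ [m+kn]%n≡m%n 1 (x * n) d ⟩
      1 % d                               ∎)
    where open ≡-Reasoning
          open +-*-Solver

  -- The numerical semigroup ⟨p,q⟩: with j < p the solution of j q ≡ k (mod p),
  -- k is of the form i p + j′ q exactly when j q ≤ k.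
  module Semigroup (p′ q′ x : ℕ) (p≤q′ : suc p′ ≤ q′) (xq≡1 : (x * suc q′) % suc p′ ≡ 1 % suc p′) where

    p q : ℕ
    p = suc p′
    q = suc q′

    residue : ℕ → ℕ
    residue k = (k * x) % p

    infix 4 _∈S _∈S?

    _∈S : ℕ → Set
    k ∈S = residue k * q ≤ k

    _∈S? : Decidable _∈S
    k ∈S? = residue k * q ≤? k

    residue≤p′ : ∀ k → residue k ≤ p′
    residue≤p′ k = s≤s⁻¹ (m%n<n (k * x) p)

    residue-+p : ∀ k → residue (k + p) ≡ residue k
    residue-+p k = begin
      ((k + p) * x) % p    ≡⟨ %-congˡ {o = p} (*-distribʳ-+ x k p) ⟩
      (k * x + p * x) % p  ≡⟨ %-congˡ {o = p} (cong (k * x +_) (*-comm p x)) ⟩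
      (k * x + x * p) % p  ≡⟨ [m+kn]%n≡m%n (k * x) x p ⟩
      (k * x) % p          ∎
      where open ≡-Reasoning

    k*[xq]≡k : ∀ k → (k * (x * q)) % p ≡ k % p
    k*[xq]≡k k = begin
      (k * (x * q)) % p              ≡⟨ %-distribˡ-* k (x * q) p ⟩
      ((k % p) * ((x * q) % p)) % p  ≡⟨ %-congˡ {o = p} (cong (k % p *_) xq≡1) ⟩
      ((k % p) * (1 % p)) % p        ≡⟨ %-distribˡ-* k 1 p ⟨
      (k * 1) % p                    ≡⟨ %-congˡ {o = p} (*-identityʳ k) ⟩
      k % p                          ∎
      where open ≡-Reasoning

    residue*q≡k : ∀ k → (residue k * q) % p ≡ k % p
    residue*q≡k k = begin
      ((k * x) % p * q) % p              ≡⟨ %-distribˡ-* ((k * x) % p) q p ⟩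
      ((k * x) % p % p * (q % p)) % p    ≡⟨ %-congˡ {o = p} (cong (_* (q % p)) (m%n%n≡m%n (k * x) p)) ⟩
      ((k * x) % p * (q % p)) % p        ≡⟨ %-distribˡ-* (k * x) q p ⟨
      (k * x * q) % p                    ≡⟨ %-congˡ {o = p} (*-assoc k x q) ⟩
      (k * (x * q)) % p                  ≡⟨ k*[xq]≡k k ⟩
      k % p                              ∎
      where open ≡-Reasoning

    residue-*q : ∀ {j} → j ≤ p′ → residue (j * q) ≡ j
    residue-*q {j} j≤p′ = begin
      (j * q * x) % p    ≡⟨ %-congˡ {o = p} (trans (*-assoc j q x) (cong (j *_) (*-comm q x))) ⟩
      (j * (x * q)) % p  ≡⟨ k*[xq]≡k j ⟩
      j % p              ≡⟨ m≤n⇒m%n≡m j≤p′ ⟩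
      j                  ∎
      where open ≡-Reasoning

    0∈S : 0 ∈S
    0∈S = ≤-refl

    ∈S-+p : ∀ {k} → k ∈S → k + p ∈S
    ∈S-+p {k} k∈ = ≤-trans (subst (λ r → r * q ≤ k) (sym (residue-+p k)) k∈) (m≤m+n k p)

    p∈S : p ∈S
    p∈S = ∈S-+p 0∈S

    -- Since p < q, the inequality j q ≤ k < p leaves only j = 0, and then p would divide k.
    ∉S-<p : ∀ {k} → 0 < k → k < p → ¬ k ∈S
    ∉S-<p {k} 0<k k<p k∈ with residue k | residue*q≡k k
    ... | zero  | 0≡k = <⇒≢ 0<k (trans 0≡k (m<n⇒m%n≡m k<p))
    ... | suc r | _   = <⇒≱ (<-trans k<p (s≤s p≤q′)) (≤-trans (m≤m+n q (r * q)) k∈)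

    -- The bound keeps the cofactor j in k = j q below p, so j is its own residue.
    q-multiple : ∀ {k} → q ∣ k → k ≤ p′ * q → residue k * q ≡ k
    q-multiple (divides j refl) jq≤ = cong (_* q) (residue-*q (*-cancelʳ-≤ j p′ q jq≤))

    -- The only elements k of S with k − p ∉ S are the multiples j q with j < p.
    ∈S-step : ∀ {k} → k + p ∈S → k ∈S ⊎ q ∣ k + p
    ∈S-step {k} k+p∈ with k ∈S?
    ... | yes k∈ = inj₁ k∈
    ... | no  k∉ = inj₂ (divides (residue (k + p)) (≤-antisym (≮⇒≥ rq≮k+p) k+p∈))
      where
      -- Both sides agree modulo p, so a strict inequality would leave room for a whole p and put k
      -- into S.
      rq≮k+p : ¬ residue (k + p) * q < k + p
      rq≮k+p rq<k+p = k∉ (subst (λ r → r * q ≤ k) (residue-+p k)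
        (+-cancelʳ-≤ p _ _ (≡-mod⇒+≤ p (residue*q≡k (k + p)) rq<k+p)))

    multiple⇒∈S : ∀ {k} → k ≤ p′ * q → q ∣ k → k ∈S
    multiple⇒∈S k≤ q∣k = ≤-reflexive (q-multiple q∣k k≤)

    -- k and k + p share the residue j. If q divided k + p, then j q = k + p, whereas k ∈ S means j
    -- q ≤ k.
    ∈S⇒+p∤ : ∀ {k} → k + p ≤ p′ * q → k ∈S → q ∤ k + p
    ∈S⇒+p∤ {k} k+p≤ k∈ q∣k+p = m+1+n≰m k (begin
      k + p                 ≡⟨ q-multiple q∣k+p k+p≤ ⟨
      residue (k + p) * q   ≡⟨ cong (_* q) (residue-+p k) ⟩
      residue k * q         ≤⟨ k∈ ⟩
      k                     ∎)
      where open ≤-Reasoning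

    -- With c = p′ q′ this says c - 1 = p′ q - p = p q - p - q, the Frobenius number of ⟨p,q⟩.
    p′q′+p≡1+p′q : p′ * q′ + p ≡ suc (p′ * q)
    p′q′+p≡1+p′q = begin
      p′ * q′ + suc p′    ≡⟨ +-suc _ p′ ⟩
      suc (p′ * q′ + p′)  ≡⟨ cong suc (+-comm _ p′) ⟩
      suc (p′ + p′ * q′)  ≡⟨ cong suc (*-suc p′ q′) ⟨
      suc (p′ * q)        ∎
      where open ≡-Reasoning

    -- If k < j q, the congruence modulo p gives k + p ≤ j q ≤ p′ q < c + p, against c ≤ k.
    conductor≤⇒∈S : ∀ {k} → p′ * q′ ≤ k → k ∈S
    conductor≤⇒∈S {k} c≤k = ≮⇒≥ λ k<rq → <⇒≱ (begin-strict
      residue k * q  ≤⟨ *-monoˡ-≤ q (residue≤p′ k) ⟩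
      p′ * q         <⟨ n<1+n _ ⟩
      suc (p′ * q)   ≡⟨ p′q′+p≡1+p′q ⟨
      p′ * q′ + p    ≤⟨ +-monoˡ-≤ p c≤k ⟩
      k + p          ∎) (≡-mod⇒+≤ p (sym (residue*q≡k k)) k<rq)
      where open ≤-Reasoning

    -- From d + p = p′ q the residue of d is p′, and p′ q exceeds d. This makes the top coefficient
    -- of the semigroup polynomial 1.
    conductor∸1∉S : ∀ {d} → suc d ≡ p′ * q′ → ¬ d ∈S
    conductor∸1∉S {d} 1+d≡c d∈ = m+1+n≰m d (begin
      d + p                  ≡⟨ d+p≡p′q ⟩
      p′ * q                 ≡⟨ cong (_* q) (residue-*q ≤-refl) ⟨
      residue (p′ * q) * q   ≡⟨ cong (λ k → residue k * q) d+p≡p′q ⟨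
      residue (d + p) * q    ≡⟨ cong (_* q) (residue-+p d) ⟩
      residue d * q          ≤⟨ d∈ ⟩
      d                      ∎)
      where
      open ≤-Reasoning
      d+p≡p′q : d + p ≡ p′ * q
      d+p≡p′q = suc-injective (trans (cong (_+ p) 1+d≡c) p′q′+p≡1+p′q)

  -- Counting totatives

  count : ∀ {P : Pred ℕ 0ℓ} → Decidable P → ℕ → ℕ
  count P? n = length (filter P? (applyUpTo suc n))

  module _ {P : Pred ℕ 0ℓ} (P? : Decidable P) where

    private
      count-suc : ∀ n → count P? (suc n) ≡ count P? n + length (filter P? (suc n ∷ []))
      count-suc n = begin
        length (filter P? (applyUpTo suc (suc n)))
          ≡⟨ cong (length ∘ filter P?) (applyUpTo-∷ʳ suc n) ⟨
        length (filter P? (applyUpTo suc n ++ suc n ∷ []))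
          ≡⟨ cong length (filter-++ P? (applyUpTo suc n) _) ⟩
        length (filter P? (applyUpTo suc n) ++ filter P? (suc n ∷ []))
          ≡⟨ length-++ (filter P? (applyUpTo suc n)) ⟩
        count P? n + length (filter P? (suc n ∷ [])) ∎
        where open ≡-Reasoning

    count-yes : ∀ {n} → P (suc n) → count P? (suc n) ≡ suc (count P? n)
    count-yes {n} Pn = trans (count-suc n)
      (trans (cong (λ xs → count P? n + length xs) (filter-accept P? Pn)) (+-comm _ 1))

    count-no : ∀ {n} → ¬ P (suc n) → count P? (suc n) ≡ count P? n
    count-no {n} ¬Pn = trans (count-suc n)
      (trans (cong (λ xs → count P? n + length xs) (filter-reject P? ¬Pn)) (+-identityʳ _))

  count-multiples : ∀ d .{{_ : NonZero d}} m r → r < d → count (d ∣?_) (r + m * d) ≡ m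
  count-multiples d zero zero _ = refl
  -- The predecessor of (m + 1) d is d′ + m d, so the remainder restarts at d′.
  count-multiples d@(suc d′) (suc m) zero _ =
    trans (count-yes (d ∣?_) (n∣m*n (suc m))) (cong suc (count-multiples d m d′ ≤-refl))
  count-multiples d m (suc r) 1+r<d =
    trans (count-no (d ∣?_) d∤) (count-multiples d m r (<-trans (n<1+n r) 1+r<d))
    where
    d∤ : d ∤ suc r + m * d
    d∤ d∣ = <⇒≱ 1+r<d (∣⇒≤ (∣m+n∣m⇒∣n (subst (d ∣_) (+-comm (suc r) _) d∣) (n∣m*n m)))

  Totative : ℕ → ℕ → Set
  Totative n j = gcd j n ≡ 1

  totative? : ∀ n → Decidable (Totative n)
  totative? n j = gcd j n ≟ 1

  module _ {p q} (p-prime : Prime p) (q-prime : Prime q) (p<q : p < q) where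

    primes-coprime : Coprime q p
    primes-coprime = prime⇒coprime q-prime {{prime⇒nonZero p-prime}} p<q

    private
      ∣⇒¬totative : ∀ {r j} → Prime r → r ∣ j → r ∣ p * q → ¬ Totative (p * q) j
      ∣⇒¬totative r-prime r∣j r∣pq t =
        ¬prime[1] (subst Prime (∣1⇒≡1 (subst (_ ∣_) t (gcd-greatest r∣j r∣pq))) r-prime)

      ∤⇒coprime : ∀ {r j} → Prime r → r ∤ j → Coprime j r
      ∤⇒coprime r-prime r∤j (d∣j , d∣r) with prime⇒irreducible r-prime d∣r
      ... | inj₁ d≡1 = d≡1
      ... | inj₂ refl = contradiction d∣j r∤j

      *-∣ : ∀ {j} → p ∣ j → q ∣ j → p * q ∣ j
      *-∣ (divides k refl) q∣kp = subst (p * q ∣_) (*-comm p k) (*-monoʳ-∣ p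
        (coprime-divisor primes-coprime (subst (q ∣_) (*-comm k p) q∣kp)))

    totative⇒∤ : ∀ {j} → Totative (p * q) j → p ∤ j × q ∤ j
    totative⇒∤ t = (λ p∣j → ∣⇒¬totative p-prime p∣j (m∣m*n q) t)
                 , (λ q∣j → ∣⇒¬totative q-prime q∣j (n∣m*n p) t)

    -- A common divisor d of j and p q is coprime to p because p ∤ j; hence d divides q, and q ∤ j
    -- leaves d = 1.
    ∤⇒totative : ∀ {j} → p ∤ j → q ∤ j → Totative (p * q) j
    ∤⇒totative {j} p∤j q∤j = coprime⇒gcd≡1 λ (d∣j , d∣pq) → ∤⇒coprime q-prime q∤j
      (d∣j , coprime-divisor (λ (e∣d , e∣p) → ∤⇒coprime p-prime p∤j (∣-trans e∣d d∣j , e∣p)) d∣pq)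

    -- Induction on `n` over the four divisibility classes of n + 1: both sides grow by 2 if p and q
    -- divide it and by 1 otherwise. Sums on both sides avoid truncated subtraction.
    count-inclusion-exclusion : ∀ n →
      count (totative? (p * q)) n + (count (p ∣?_) n + count (q ∣?_) n) ≡ n + count (p * q ∣?_) n
    count-inclusion-exclusion zero = refl
    count-inclusion-exclusion (suc n) with p ∣? suc n | q ∣? suc n
    ... | yes p∣ | yes q∣
      rewrite count-no (totative? (p * q)) {n} (∣⇒¬totative p-prime p∣ (m∣m*n q))
            | count-yes (p ∣?_) {n} p∣ | count-yes (q ∣?_) {n} q∣ | count-yes (p * q ∣?_) {n} (*-∣ p∣ q∣)
      = trans (lemma (count (totative? (p * q)) n) (count (p ∣?_) n) (count (q ∣?_) n))
              (trans (cong (2 +_) (count-inclusion-exclusion n)) (cong suc (sym (+-suc n _))))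
      where
      open +-*-Solver
      lemma : ∀ a b c → a + (suc b + suc c) ≡ 2 + (a + (b + c))
      lemma = solve 3 (λ a b c → a :+ (con 1 :+ b :+ (con 1 :+ c)) := con 2 :+ (a :+ (b :+ c))) refl
    ... | yes p∣ | no q∤
      rewrite count-no (totative? (p * q)) {n} (∣⇒¬totative p-prime p∣ (m∣m*n q))
            | count-yes (p ∣?_) {n} p∣ | count-no (q ∣?_) {n} q∤
            | count-no (p * q ∣?_) {n} (q∤ ∘ ∣-trans (n∣m*n p))
      = trans (+-suc _ _) (cong suc (count-inclusion-exclusion n))
    ... | no p∤ | yes q∣
      rewrite count-no (totative? (p * q)) {n} (∣⇒¬totative q-prime q∣ (n∣m*n p))
            | count-no (p ∣?_) {n} p∤ | count-yes (q ∣?_) {n} q∣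
            | count-no (p * q ∣?_) {n} (p∤ ∘ ∣-trans (m∣m*n q))
      = trans (cong (count (totative? (p * q)) n +_) (+-suc _ _))
              (trans (+-suc _ _) (cong suc (count-inclusion-exclusion n)))
    ... | no p∤ | no q∤
      rewrite count-yes (totative? (p * q)) {n} (∤⇒totative p∤ q∤)
            | count-no (p ∣?_) {n} p∤ | count-no (q ∣?_) {n} q∤
            | count-no (p * q ∣?_) {n} (p∤ ∘ ∣-trans (m∣m*n q))
      = cong suc (count-inclusion-exclusion n)

  -- Euler's φ(p q): up to p q there are q multiples of p, p multiples of q and one of p q. It is
  -- the number of linear factors of Φ.
  count-totatives : ∀ {p′ q′} → Prime (suc p′) → Prime (suc q′) → p′ < q′ →
                    count (totative? (suc p′ * suc q′)) (suc p′ * suc q′) ≡ p′ * q′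
  count-totatives {p′} {q′} p-prime q-prime p′<q′ = +-cancelʳ-≡ (q + p) _ _ (begin
    count (totative? (p * q)) (p * q) + (q + p)
      ≡⟨ cong₂ (λ a b → count (totative? (p * q)) (p * q) + (a + b)) #p #q ⟨
    count (totative? (p * q)) (p * q) + (count (p ∣?_) (p * q) + count (q ∣?_) (p * q))
      ≡⟨ count-inclusion-exclusion p-prime q-prime (s≤s p′<q′) (p * q) ⟩
    p * q + count (p * q ∣?_) (p * q)
      ≡⟨ cong (p * q +_) #pq ⟩
    p * q + 1
      ≡⟨ solve 2 (λ a b → (con 1 :+ a) :* (con 1 :+ b) :+ con 1
                       := a :* b :+ (con 1 :+ b :+ (con 1 :+ a))) refl p′ q′ ⟩
    p′ * q′ + (q + p) ∎)
    where
    open ≡-Reasoning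
    open +-*-Solver
    p = suc p′
    q = suc q′

    #p : count (p ∣?_) (p * q) ≡ q
    #p = trans (cong (count (p ∣?_)) (*-comm p q)) (count-multiples p q 0 z<s)

    #q : count (q ∣?_) (p * q) ≡ p
    #q = count-multiples q p 0 z<s

    #pq : count (p * q ∣?_) (p * q) ≡ 1
    #pq = trans (cong (count (p * q ∣?_)) (sym (*-identityˡ (p * q)))) (count-multiples (p * q) 1 0 z<s)

  -- Gaps of sorted lists and changes of Boolean sequences

  ∈-tail : ∀ {x y : ℕ} {es} → x < y → y ∈ x ∷ es → y ∈ es
  ∈-tail x<x (here refl) = contradiction x<x (<-irrefl refl)
  ∈-tail _   (there y∈)  = y∈

  consecutive⇒∈gaps : ∀ {es e f} → AllPairs _<_ es → e ∈ es → f ∈ es → e < f →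
                      (∀ {g} → g ∈ es → e < g → f ≤ g) → f ∸ e ∈ gaps es
  consecutive⇒∈gaps {e ∷ []} _ (here refl) f∈ e<f _ with () ← ∈-tail e<f f∈
  consecutive⇒∈gaps {e ∷ e′ ∷ _} (e<es ∷ e′<es ∷ _) (here refl) f∈ e<f next with ∈-tail e<f f∈
  ... | here refl  = here refl
  -- If `f` is not the second entry, that entry lies strictly between `e` and `f`.
  ... | there f∈es = contradiction (next (there (here refl)) (All.head e<es)) (<⇒≱ (All.lookup e′<es f∈es))
  consecutive⇒∈gaps {_ ∷ _ ∷ _} (x<es ∷ es-sorted) (there e∈) f∈ e<f next = there
    (consecutive⇒∈gaps es-sorted e∈ (∈-tail (<-trans (All.lookup x<es e∈) e<f) f∈) e<f (next ∘ there))

  -- Any entry in (e, e + b] suffices, because the successor of `e` is the least entry above `e`.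
  -- Only an `e` with a later entry `f` starts a gap.
  gaps-bounded : ∀ {es b} → AllPairs _<_ es →
                 (∀ {e f} → e ∈ es → f ∈ es → e < f → ∃[ g ] g ∈ es × e < g × g ≤ e + b) →
                 All (_≤ b) (gaps es)
  gaps-bounded {[]} _ _ = []
  gaps-bounded {_ ∷ []} _ _ = []
  gaps-bounded {e ∷ e′ ∷ es} {b} (e<es ∷ sorted) next =
    m≤n+o⇒m∸n≤o e′ e e′≤e+b ∷ gaps-bounded sorted next′
    where
    e′≤e+b : e′ ≤ e + b
    e′≤e+b with next (here refl) (there (here refl)) (All.head e<es)
    ... | g , g∈ , e<g , g≤ with ∈-tail e<g g∈
    ... | here refl = g≤
    ... | there g∈′ = ≤-trans (<⇒≤ (All.lookup (AllPairs.head sorted) g∈′)) g≤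

    next′ : ∀ {e₁ f} → e₁ ∈ e′ ∷ es → f ∈ e′ ∷ es → e₁ < f → ∃[ g ] g ∈ e′ ∷ es × e₁ < g × g ≤ e₁ + b
    next′ e₁∈ f∈ e₁<f with next (there e₁∈) (there f∈) e₁<f
    ... | g , g∈ , e₁<g , g≤ = g , ∈-tail (<-trans (All.lookup e<es e₁∈) e₁<g) g∈ , e₁<g , g≤

  largestGap-≡ : ∀ {es b} → All (_≤ b) (gaps es) → b ∈ gaps es → largestGap es ≡ b
  largestGap-≡ {es} {b} gaps≤b b∈gaps = ≤-antisym
    (foldr-preservesᵇ ⊔-lub z≤n gaps≤b)
    (foldr-preservesᵒ {P = b ≤_} {f = _⊔_} ≤-⊔ 0 (gaps es) (inj₂ (Any.map ≤-reflexive b∈gaps)))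
    where
    ≤-⊔ : ∀ m n → b ≤ m ⊎ b ≤ n → b ≤ m ⊔ n
    ≤-⊔ m n (inj₁ b≤m) = ≤-trans b≤m (m≤m⊔n m n)
    ≤-⊔ m n (inj₂ b≤n) = ≤-trans b≤n (m≤n⊔m m n)

  module Changes (b : ℕ → Bool) where

    Change : ℕ → Set
    Change k = b (suc k) ≢ b k

    change? : Decidable Change
    change? k = ¬? (b (suc k) ≟ᵇ b k)

    changes : ℕ → List ℕ
    changes n = filter change? (upTo n)

    changes-sorted : ∀ n → AllPairs _<_ (changes n)
    changes-sorted n = AllPairs.filter⁺ change? (AllPairs.applyUpTo⁺₁ _ n (λ i<j _ → i<j))

    -- Used with m = p′, so that a constant window has p entries, one for each residue class modulo
    -- p.
    change-or-constant : ∀ k m → (∃[ i ] i < m × Change (k + i)) ⊎ (∀ i → i ≤ m → b (k + i) ≡ b k)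
    change-or-constant k zero = inj₂ λ { zero _ → cong b (+-identityʳ k) }
    change-or-constant k (suc m) with change-or-constant k m
    ... | inj₁ (i , i<m , ch) = inj₁ (i , <-trans i<m (n<1+n m) , ch)
    ... | inj₂ const with b (suc (k + m)) ≟ᵇ b (k + m)
    ...   | no  ch = inj₁ (m , n<1+n m , ch)
    ...   | yes eq = inj₂ λ i i≤1+m → case m≤n⇒m<n∨m≡n i≤1+m of λ where
            (inj₁ i<1+m) → const i (s≤s⁻¹ i<1+m)
            (inj₂ refl)  → trans (cong b (+-suc k m)) (trans eq (const m ≤-refl))

    module _ {p′} (b-+p : ∀ {k} → b k ≡ true → b (k + suc p′) ≡ true) where

      private
        p = suc p′

        b-+*p : ∀ {k} t → b k ≡ true → b (k + t * p) ≡ true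
        b-+*p {k} zero    bk = trans (cong b (+-identityʳ k)) bk
        b-+*p {k} (suc t) bk = trans (cong b (sym (+-assoc k p (t * p)))) (b-+*p t (b-+p bk))

      -- A run of p true values meets every residue class modulo p, and steps of p carry truth
      -- upwards from each.
      true-run⇒true : ∀ {k} → (∀ i → i ≤ p′ → b (k + i) ≡ true) → ∀ {m} → k ≤ m → b m ≡ true
      true-run⇒true {k} run {m} k≤m = begin
        b m                              ≡⟨ cong b (m+[n∸m]≡n k≤m) ⟨
        b (k + t)                        ≡⟨ cong (b ∘ (k +_)) (m≡m%n+[m/n]*n t p) ⟩
        b (k + (t % p + t / p * p))      ≡⟨ cong b (+-assoc k (t % p) _) ⟨
        b (k + t % p + t / p * p)        ≡⟨ b-+*p (t / p) (run (t % p) (s≤s⁻¹ (m%n<n t p))) ⟩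
        true                             ∎
        where
        open ≡-Reasoning
        t = m ∸ k

      -- If `f` is more than p′ away, the p values after `e` cannot be constant. Constantly false,
      -- they would contradict b (e + p), true like b e; constantly true, they would keep b true
      -- past `f`, where it changes. The bound g ≤ f keeps `g` in a truncated list of changes.
      next-change : ∀ {e f} → Change e → Change f → e < f →
                    ∃[ g ] Change g × e < g × g ≤ e + p′ × g ≤ f
      next-change {e} {f} che chf e<f with f ≤? e + p′
      ... | yes f≤ = f , chf , e<f , f≤ , ≤-refl
      ... | no  f≰ with change-or-constant (suc e) p′
      ...   | inj₁ (i , i<p′ , chg) = suc e + i , chg , m≤m+n (suc e) i , g≤ , ≤-trans g≤ (<⇒≤ (≰⇒> f≰))
        where
        g≤ : suc e + i ≤ e + p′
        g≤ = ≤-trans (≤-reflexive (sym (+-suc e i))) (+-monoʳ-≤ e i<p′)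
      ...   | inj₂ const with b e in be
      ...     | true  = contradiction
        (trans (sym (const p′ ≤-refl)) (trans (cong b (sym (+-suc e p′))) (b-+p be))) che
      ...     | false = contradiction (trans (all-true (m≤n⇒m≤1+n e<f)) (sym (all-true e<f))) chf
        where
        all-true : ∀ {m} → suc e ≤ m → b m ≡ true
        all-true = true-run⇒true λ i i≤p′ → trans (const i i≤p′) (¬-not che)

      changes-gaps-bounded : ∀ n → All (_≤ p′) (gaps (changes n))
      changes-gaps-bounded n = gaps-bounded (changes-sorted n) λ e∈ f∈ e<f →
        let _ , che   = ∈-filter⁻ change? {xs = upTo n} e∈
            f<n , chf = ∈-filter⁻ change? {xs = upTo n} f∈
            g , chg , e<g , g≤e+p′ , g≤f = next-change che chf e<f
        in g , ∈-filter⁺ change? (∈-upTo⁺ (≤-<-trans g≤f (∈-upTo⁻ f<n))) chg , e<g , g≤e+p′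

  -- Gaps of the coefficient sequence of the semigroup.

  module SemigroupGaps (p′ q′ x : ℕ) (0<p′ : 0 < p′) (p≤q′ : suc p′ ≤ q′)
                       (xq≡1 : (x * suc q′) % suc p′ ≡ 1 % suc p′) where

    open Semigroup p′ q′ x p≤q′ xq≡1

    -- The coefficient of Xᵏ in Φ is [k ∈ S] − [k − 1 ∈ S]; the shift makes k = 0 regular.
    pred∈S : ℕ → Bool
    pred∈S zero    = false
    pred∈S (suc k) = does (k ∈S?)

    open Changes pred∈S public

    pred∈S-+p : ∀ {k} → pred∈S k ≡ true → pred∈S (k + p) ≡ true
    pred∈S-+p {suc k} k∈ = dec-true (k + p ∈S?)
      (∈S-+p (invert (subst (Reflects (k ∈S)) k∈ (proof (k ∈S?)))))

    pred∈S-<p : ∀ {k} → 0 < k → k ≤ p′ → pred∈S (suc k) ≡ false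
    pred∈S-<p 0<k k≤p′ = dec-false (_ ∈S?) (∉S-<p 0<k (s≤s k≤p′))

    change-1 : Change 1
    change-1 eq with () ← trans (sym (dec-true (0 ∈S?) 0∈S)) (trans (sym eq) (pred∈S-<p z<s 0<p′))

    change-p : Change p
    change-p eq with () ← trans (sym (dec-true (p ∈S?) p∈S)) (trans eq (dec-false (p′ ∈S?) (∉S-<p 0<p′ ≤-refl)))

    -- For 1 < k < p neither k - 1 nor k belongs to S.
    no-change-<p : ∀ {k} → 1 < k → Change k → p ≤ k
    no-change-<p {suc k} 1<k ch = ≮⇒≥ λ k<p → ch (trans
      (pred∈S-<p z<s (s≤s⁻¹ k<p)) (sym (pred∈S-<p (s<s⁻¹ 1<k) (<⇒≤ (s<s⁻¹ k<p)))))

    -- Puts the exponent p, the upper end of the extremal gap, within the degree.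
    p≤p′q′ : p ≤ p′ * q′
    p≤p′q′ = ≤-trans p≤q′ (m≤n*m q′ p′ {{>-nonZero 0<p′}})

    largestGap-changes : largestGap (changes (suc (p′ * q′))) ≡ p′
    largestGap-changes = largestGap-≡ {changes n} (changes-gaps-bounded (λ {k} → pred∈S-+p {k}) n)
      (consecutive⇒∈gaps (changes-sorted n)
        (∈-filter⁺ change? (∈-upTo⁺ (s≤s (≤-trans (m≤n⇒m≤1+n 0<p′) p≤p′q′))) change-1)
        (∈-filter⁺ change? (∈-upTo⁺ (s≤s p≤p′q′)) change-p)
        (s≤s 0<p′)
        (λ g∈ 1<g → no-change-<p 1<g (proj₂ (∈-filter⁻ change? {xs = upTo n} g∈))))
      where n = suc (p′ * q′)

open Arithmetic

-- Evaluation, linear factors and roots of polynomials.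

module Polynomials {c ℓ} (R : CommutativeRing c ℓ) where

  open CommutativeRing R
  open import Algebra.Properties.Ring ring using (-‿distribˡ-*; -0#≈0#; +-cancelʳ) renaming (x∙y⁻¹≈ε⇒x≈y to x-y≈0⇒x≈y)
  open import Algebra.Properties.Semiring.Exp semiring using (_^_; ^-homo-*; ^-assocʳ; ^-congˡ)
  open import Algebra.Solver.Ring.NaturalCoefficients.Default commutativeSemiring
    using (solve; _:=_; _:+_; _:*_; con)
  open import Relation.Binary.Reasoning.Setoid setoid

  private
    Polynomial : Set c
    Polynomial = Poly R

    coef : Polynomial → ℕ → Carrier
    coef = coeff R

    infix 4 _≋_
    infixl 6 _⊕_
    infixl 7 _⊗_

    _≋_ : Polynomial → Polynomial → Set ℓ
    _≋_ = _≈ₚ_ R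

    _⊕_ _⊗_ : Polynomial → Polynomial → Polynomial
    _⊕_ = _+ₚ_ R
    _⊗_ = _*ₚ_ R

    X-_ : Carrier → Polynomial
    X-_ = Defs.X-_ R

  -- Phrased as cancellation, not as a disjunction, because a Heyting field need not decide which
  -- factor vanishes.
  NoZeroDivisors : Set _
  NoZeroDivisors = ∀ {x y} → x ≉ 0# → x * y ≈ 0# → y ≈ 0#

  eval : Polynomial → Carrier → Carrier
  eval []      x = 0#
  eval (a ∷ f) x = a + x * eval f x

  coeff-+ₚ : ∀ f g k → coef (f ⊕ g) k ≈ coef f k + coef g k
  coeff-+ₚ []      g       k       = sym (+-identityˡ _)
  coeff-+ₚ (a ∷ f) []      k       = sym (+-identityʳ _)
  coeff-+ₚ (a ∷ f) (b ∷ g) zero    = refl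
  coeff-+ₚ (a ∷ f) (b ∷ g) (suc k) = coeff-+ₚ f g k

  coeff-map-* : ∀ a g k → coef (map (a *_) g) k ≈ a * coef g k
  coeff-map-* a []      k       = sym (zeroʳ a)
  coeff-map-* a (b ∷ g) zero    = refl
  coeff-map-* a (b ∷ g) (suc k) = coeff-map-* a g k

  -- `0# ∷ g` is X g, which covers k = 0 without a separate formula.
  coeff-X-* : ∀ r g k → coef ((X- r) ⊗ g) k ≈ - r * coef g k + coef (0# ∷ g) k
  coeff-X-* r g k = trans (coeff-+ₚ (map (- r *_) g) _ k) (+-cong (coeff-map-* (- r) g k) (1*g k))
    where
    1*g : ∀ k → coef (0# ∷ [ 1# ] ⊗ g) k ≈ coef (0# ∷ g) k
    1*g zero    = refl
    1*g (suc k) = begin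
      coef ([ 1# ] ⊗ g) k                 ≈⟨ coeff-+ₚ (map (1# *_) g) [ 0# ] k ⟩
      coef (map (1# *_) g) k + coef [ 0# ] k   ≈⟨ +-cong (trans (coeff-map-* 1# g k) (*-identityˡ _)) (0ₚ k) ⟩
      coef g k + 0#                            ≈⟨ +-identityʳ _ ⟩
      coef g k                                 ∎
      where
      0ₚ : ∀ k → coef [ 0# ] k ≈ 0#
      0ₚ zero    = refl
      0ₚ (suc k) = refl

  X-*-congˡ : ∀ r f g → f ≋ g → (X- r) ⊗ f ≋ (X- r) ⊗ g
  X-*-congˡ r f g f≈g k = begin
    coef ((X- r) ⊗ f) k        ≈⟨ coeff-X-* r f k ⟩
    - r * coef f k + coef (0# ∷ f) k   ≈⟨ +-cong (*-congˡ (f≈g k)) (tail k) ⟩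
    - r * coef g k + coef (0# ∷ g) k   ≈⟨ coeff-X-* r g k ⟨
    coef ((X- r) ⊗ g) k        ∎
    where
    tail : ∀ k → coef (0# ∷ f) k ≈ coef (0# ∷ g) k
    tail zero    = refl
    tail (suc k) = f≈g k

  -- Horner's scheme: the quotient of a ∷ f by X − r is hornerValues r f.
  hornerValues : Carrier → Polynomial → Polynomial
  hornerValues r []      = []
  hornerValues r (a ∷ f) = eval (a ∷ f) r ∷ hornerValues r f

  coeff-horner-zero : ∀ r f → coef (hornerValues r f) 0 ≈ eval f r
  coeff-horner-zero r []      = refl
  coeff-horner-zero r (a ∷ f) = refl

  -- Entry k of `hornerValues r f` is the value at `r` of `f` stripped of its k lowest coefficients.
  coeff-horner : ∀ r f k → coef f k + r * coef (hornerValues r f) (suc k) ≈ coef (hornerValues r f) k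
  coeff-horner r []      k       = trans (+-congˡ (zeroʳ r)) (+-identityʳ 0#)
  coeff-horner r (a ∷ f) zero    = +-congˡ (*-congˡ (coeff-horner-zero r f))
  coeff-horner r (a ∷ f) (suc k) = coeff-horner r f k

  private
    negate-cancel : ∀ r u v → - r * v + (u + r * v) ≈ u
    negate-cancel r u v = begin
      - r * v + (u + r * v)  ≈⟨ solve 4 (λ n r u v → n :* v :+ (u :+ r :* v) := u :+ (n :+ r) :* v) refl (- r) r u v ⟩
      u + (- r + r) * v      ≈⟨ +-congˡ (trans (*-congʳ (-‿inverseˡ r)) (zeroˡ v)) ⟩
      u + 0#                 ≈⟨ +-identityʳ u ⟩
      u                      ∎

  -- Horner's recurrence gives the higher coefficients; the root condition enters in the constant
  -- one.
  factor : ∀ r a f → eval (a ∷ f) r ≈ 0# → (X- r) ⊗ hornerValues r f ≋ a ∷ f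
  factor r a f root zero = begin
    coef ((X- r) ⊗ hornerValues r f) 0   ≈⟨ coeff-X-* r (hornerValues r f) 0 ⟩
    - r * coef (hornerValues r f) 0 + 0#           ≈⟨ +-cong (*-congˡ (coeff-horner-zero r f)) (sym root) ⟩
    - r * eval f r + (a + r * eval f r)            ≈⟨ negate-cancel r a (eval f r) ⟩
    a                                              ∎
  factor r a f root (suc k) = begin
    coef ((X- r) ⊗ h) (suc k)                         ≈⟨ coeff-X-* r h (suc k) ⟩
    - r * coef h (suc k) + coef h k                           ≈⟨ +-congˡ (coeff-horner r f k) ⟨
    - r * coef h (suc k) + (coef f k + r * coef h (suc k))    ≈⟨ negate-cancel r _ _ ⟩
    coef f k                                                  ∎
    where h = hornerValues r f

  -- Division with remainder by X - r, in evaluated form. It passes the other roots on to the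
  -- quotient.
  eval-factor : ∀ r x a f → eval (a ∷ f) x ≈ (x - r) * eval (hornerValues r f) x + eval (a ∷ f) r
  eval-factor r x a [] = begin
    a + x * 0#                   ≈⟨ +-congˡ (trans (zeroʳ x) (sym (zeroʳ r))) ⟩
    a + r * 0#                   ≈⟨ trans (+-congʳ (zeroʳ _)) (+-identityˡ _) ⟨
    (x - r) * 0# + (a + r * 0#)  ∎
  eval-factor r x a f@(b ∷ f′) = begin
    a + x * eval f x                               ≈⟨ +-congˡ (*-congˡ (eval-factor r x b f′)) ⟩
    a + x * ((x - r) * h + eval f r)               ≈⟨ negate-cancel r _ (eval f r) ⟨
    - r * eval f r + (a + x * ((x - r) * h + eval f r) + r * eval f r)
      ≈⟨ solve 6 (λ n r a x h e → n :* e :+ (a :+ x :* ((x :+ n) :* h :+ e) :+ r :* e)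
                              := (x :+ n) :* (e :+ x :* h) :+ (a :+ r :* e)) refl (- r) r a x h (eval f r) ⟩
    (x - r) * (eval f r + x * h) + (a + r * eval f r) ∎
    where h = eval (hornerValues r f′) x

  -- The list has exactly n + 1 entries, so the degree is visible in its structure and can be
  -- counted down along the roots.
  data Monic : ℕ → Polynomial → Set (c Level.⊔ ℓ) where
    unit : ∀ {a} → a ≈ 1# → Monic 0 [ a ]
    _∷_  : ∀ a {n f} → Monic n f → Monic (suc n) (a ∷ f)

  horner-monic : ∀ r {n f} → Monic n f → Monic n (hornerValues r f)
  horner-monic r (unit a≈1)  = unit (trans (+-congˡ (zeroʳ r)) (trans (+-identityʳ _) a≈1))
  horner-monic r (a ∷ monic) = _ ∷ horner-monic r monic

  applyUpTo-monic : ∀ f n → f n ≈ 1# → Monic n (applyUpTo f (suc n))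
  applyUpTo-monic f zero    fn≈1 = unit fn≈1
  applyUpTo-monic f (suc n) fn≈1 = f 0 ∷ applyUpTo-monic (f ∘ suc) n fn≈1

  -- Dividing by X - r leaves a monic quotient, and each other root s remains a root of it because s
  -- - r can be cancelled.
  product-of-roots : NoZeroDivisors → ∀ rs {f} → Monic (length rs) f → AllPairs _≉_ rs →
                     All (λ r → eval f r ≈ 0#) rs → productₚ R (map X-_ rs) ≋ f
  product-of-roots nzd [] (unit a≈1) _ _ zero    = sym a≈1
  product-of-roots nzd [] (unit a≈1) _ _ (suc k) = refl
  product-of-roots nzd (r ∷ rs) {a ∷ f} (a ∷ monic) (r≉rs ∷ distinct) (root ∷ roots) k =
    trans (X-*-congˡ r (productₚ R (map X-_ rs)) (hornerValues r f) (product-of-roots nzd rs (horner-monic r monic) distinct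
                         (All.zipWith (λ (r≉s , s-root) → root-of-quotient r≉s s-root) (r≉rs , roots))) k)
          (factor r a f root k)
    where
    root-of-quotient : ∀ {s} → r ≉ s → eval (a ∷ f) s ≈ 0# → eval (hornerValues r f) s ≈ 0#
    root-of-quotient {s} r≉s s-root = nzd (r≉s ∘ sym ∘ x-y≈0⇒x≈y s r) (begin
      (s - r) * eval (hornerValues r f) s                     ≈⟨ +-identityʳ _ ⟨
      (s - r) * eval (hornerValues r f) s + 0#                ≈⟨ +-congˡ root ⟨
      (s - r) * eval (hornerValues r f) s + eval (a ∷ f) r    ≈⟨ eval-factor r s a f ⟨
      eval (a ∷ f) s                                          ≈⟨ s-root ⟩
      0#                                                      ∎)

  -- Sparse form of a dense polynomial

  sumMonomials : (ℕ → Carrier) → List ℕ → Polynomial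
  sumMonomials a ks = sumₚ R (map (λ k → monomial R (a k) k) ks)

  private
    -- Multiplication by X commutes with sums.
    coeff-sum-shift : ∀ (g : ℕ → Polynomial) n k →
      coef (sumₚ R (applyUpTo (λ i → 0# ∷ g i) n)) k ≈ coef (0# ∷ sumₚ R (applyUpTo g n)) k
    coeff-sum-shift g zero    zero    = refl
    coeff-sum-shift g zero    (suc k) = refl
    coeff-sum-shift g (suc n) k = begin
      coef ((0# ∷ g 0) ⊕ (sumₚ R (applyUpTo (λ i → 0# ∷ g (suc i)) n))) k
        ≈⟨ coeff-+ₚ (0# ∷ g 0) (sumₚ R (applyUpTo (λ i → 0# ∷ g (suc i)) n)) k ⟩
      coef (0# ∷ g 0) k + coef (sumₚ R (applyUpTo (λ i → 0# ∷ g (suc i)) n)) k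
        ≈⟨ +-congˡ (coeff-sum-shift (g ∘ suc) n k) ⟩
      coef (0# ∷ g 0) k + coef (0# ∷ sumₚ R (applyUpTo (g ∘ suc) n)) k
        ≈⟨ add k ⟩
      coef (0# ∷ sumₚ R (applyUpTo g (suc n))) k ∎
      where
      add : ∀ k → coef (0# ∷ g 0) k + coef (0# ∷ sumₚ R (applyUpTo (g ∘ suc) n)) k
                  ≈ coef (0# ∷ sumₚ R (applyUpTo g (suc n))) k
      add zero    = +-identityʳ 0#
      add (suc k) = sym (coeff-+ₚ (g 0) _ k)

  coeff-sum-monomials : ∀ a n k → coef (sumₚ R (applyUpTo (λ i → monomial R (a i) i) n)) k ≈ coef (applyUpTo a n) k
  coeff-sum-monomials a zero    k = refl
  coeff-sum-monomials a (suc n) k = trans (coeff-+ₚ [ a 0 ] (sumₚ R (applyUpTo (λ i → monomial R (a (suc i)) (suc i)) n)) k)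
    (trans (+-congˡ (coeff-sum-shift (λ i → monomial R (a (suc i)) i) n k)) (add k))
    where
    add : ∀ k → coef [ a 0 ] k + coef (0# ∷ sumₚ R (applyUpTo (λ i → monomial R (a (suc i)) i) n)) k
                ≈ coef (applyUpTo a (suc n)) k
    add zero    = +-identityʳ (a 0)
    add (suc k) = trans (+-identityˡ _) (coeff-sum-monomials (a ∘ suc) n k)

  coeff-monomial-0 : ∀ {a} → a ≈ 0# → ∀ e k → coef (monomial R a e) k ≈ 0#
  coeff-monomial-0 a≈0 zero    zero    = a≈0
  coeff-monomial-0 a≈0 zero    (suc k) = refl
  coeff-monomial-0 a≈0 (suc e) zero    = refl
  coeff-monomial-0 a≈0 (suc e) (suc k) = coeff-monomial-0 a≈0 e k

  coeff-sum-filter : ∀ a {P : ℕ → Set} (P? : ∀ k → Dec (P k)) → (∀ {k} → ¬ P k → a k ≈ 0#) → ∀ es k →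
    coef (sumMonomials a (filter P? es)) k ≈ coef (sumMonomials a es) k
  coeff-sum-filter a P? a≈0 []       k = refl
  coeff-sum-filter a P? a≈0 (e ∷ es) k with P? e
  ... | yes _  = trans (coeff-+ₚ (monomial R (a e) e) _ k)
    (trans (+-congˡ (coeff-sum-filter a P? a≈0 es k)) (sym (coeff-+ₚ (monomial R (a e) e) _ k)))
  ... | no  ¬P = begin
    coef (sumMonomials a (filter P? es)) k                      ≈⟨ coeff-sum-filter a P? a≈0 es k ⟩
    coef (sumMonomials a es) k                                  ≈⟨ +-identityˡ _ ⟨
    0# + coef (sumMonomials a es) k                             ≈⟨ +-congʳ (coeff-monomial-0 (a≈0 ¬P) e k) ⟨
    coef (monomial R (a e) e) k + coef (sumMonomials a es) k    ≈⟨ coeff-+ₚ (monomial R (a e) e) _ k ⟨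
    coef (sumMonomials a (e ∷ es)) k                            ∎

  𝟙 : Bool → Carrier
  𝟙 b = if b then 1# else 0#

  𝟙-≢ : 1# ≉ 0# → ∀ {b b′} → b ≢ b′ → 𝟙 b - 𝟙 b′ ≉ 0#
  𝟙-≢ 1≉0 {false} {false} b≢b′ _  = b≢b′ ≡.refl
  𝟙-≢ 1≉0 {true}  {true}  b≢b′ _  = b≢b′ ≡.refl
  𝟙-≢ 1≉0 {false} {true}  _    eq = 1≉0 (sym (x-y≈0⇒x≈y 0# 1# eq))
  𝟙-≢ 1≉0 {true}  {false} _    eq = 1≉0 (x-y≈0⇒x≈y 1# 0# eq)

  module _ (b : ℕ → Bool) where

    open Changes b

    -- For b = `pred∈S` these are the coefficients of (1 - X) Σ Xˢ.
    difference : ℕ → Carrier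
    difference k = 𝟙 (b (suc k)) - 𝟙 (b k)

    terms : ℕ → List (Term R)
    terms n = map (λ k → difference k , k) (changes n)

    exponents-terms : ∀ n → map proj₂ (terms n) ≡ changes n
    exponents-terms n = ≡.trans (≡.sym (map-∘ (changes n))) (map-id (changes n))

    -- The coefficient at k is ±1 at a change and 0 elsewhere, so the changes are exactly the
    -- support.
    terms-isSparseForm : 1# ≉ 0# → ∀ {f} n → f ≋ applyUpTo difference n → IsSparseForm R f (terms n)
    terms-isSparseForm 1≉0 {f} n f≈ = record
      { nonzero    = All.map⁺ (All.map (𝟙-≢ 1≉0) (All.all-filter change? (upTo n)))
      ; increasing = ≡.subst (Linked ℕ._<_) (≡.sym (exponents-terms n)) (AllPairs⇒Linked (changes-sorted n))
      ; expansion  = λ k → begin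
          coef f k                                          ≈⟨ f≈ k ⟩
          coef (applyUpTo difference n) k                   ≈⟨ coeff-sum-monomials difference n k ⟨
          coef (sumₚ R (applyUpTo (λ i → monomial R (difference i) i) n)) k
            ≡⟨ ≡.cong (λ fs → coef (sumₚ R fs) k) (map-applyUpTo id (λ i → monomial R (difference i) i) n) ⟨
          coef (sumMonomials difference (upTo n)) k         ≈⟨ coeff-sum-filter difference change? difference≈0 (upTo n) k ⟨
          coef (sumMonomials difference (changes n)) k      ≡⟨ ≡.cong (λ fs → coef (sumₚ R fs) k) (map-∘ (changes n)) ⟩
          coef (sumₚ R (map (λ (a , e) → monomial R a e) (terms n))) k ∎
      }
      where
      difference≈0 : ∀ {k} → ¬ Change k → difference k ≈ 0#
      difference≈0 {k} ¬ch with b (suc k) ≟ᵇ b k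
      ... | yes eq = trans (+-congʳ (reflexive (≡.cong 𝟙 eq))) (-‿inverseʳ _)
      ... | no  ch = contradiction ch ¬ch

  -- Power sums

  module _ (ω : Carrier) where

    series : (ℕ → Carrier) → ℕ → Carrier
    series f n = eval (applyUpTo f n) ω

    series-cong : ∀ {f g} n → (∀ {k} → k ℕ.< n → f k ≈ g k) → series f n ≈ series g n
    series-cong zero    f≈g = refl
    series-cong (suc n) f≈g = +-cong (f≈g z<s) (*-congˡ (series-cong n (f≈g ∘ s≤s)))

    series-+ : ∀ f g n → series (λ k → f k + g k) n ≈ series f n + series g n
    series-+ f g zero    = sym (+-identityʳ 0#)
    series-+ f g (suc n) = trans (+-congˡ (*-congˡ (series-+ (f ∘ suc) (g ∘ suc) n)))
      (solve 5 (λ a b w x y → a :+ b :+ w :* (x :+ y) := a :+ w :* x :+ (b :+ w :* y)) refl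
             (f 0) (g 0) ω (series (f ∘ suc) n) (series (g ∘ suc) n))

    series-split : ∀ f m n → series f (m ℕ.+ n) ≈ series f m + ω ^ m * series (λ k → f (m ℕ.+ k)) n
    series-split f zero    n = sym (trans (+-identityˡ _) (*-identityˡ _))
    series-split f (suc m) n = trans (+-congˡ (*-congˡ (series-split (f ∘ suc) m n)))
      (solve 5 (λ a w x y z → a :+ w :* (x :+ y :* z) := a :+ w :* x :+ w :* y :* z) refl
             (f 0) ω (series (f ∘ suc) m) (ω ^ m) (series (λ k → f (suc m ℕ.+ k)) n))

    series-0 : ∀ {f} n → (∀ {k} → k ℕ.< n → f k ≈ 0#) → series f n ≈ 0#
    series-0 zero    f≈0 = refl
    series-0 (suc n) f≈0 = trans (+-cong (f≈0 z<s) (trans (*-congˡ (series-0 n (f≈0 ∘ s≤s))) (zeroʳ ω)))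
                                 (+-identityʳ 0#)

    -- The geometric sum (1 - ω) Σ ωᵏ = 1 - ωⁿ, with negative terms moved across so that semiring
    -- reasoning suffices.
    series-1 : ∀ n → series (λ _ → 1#) n + ω ^ n ≈ 1# + ω * series (λ _ → 1#) n
    series-1 zero    = trans (+-identityˡ 1#) (sym (trans (+-congˡ (zeroʳ ω)) (+-identityʳ 1#)))
    series-1 (suc n) = begin
      1# + ω * s + ω * ω ^ n    ≈⟨ solve 3 (λ w s e → con 1 :+ w :* s :+ w :* e := con 1 :+ w :* (s :+ e)) refl ω s (ω ^ n) ⟩
      1# + ω * (s + ω ^ n)      ≈⟨ +-congˡ (*-congˡ (series-1 n)) ⟩
      1# + ω * (1# + ω * s)     ∎
      where s = series (λ _ → 1#) n

    module _ (q′ : ℕ) where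

      private
        q = suc q′

        u : ℕ → Carrier
        u k = 𝟙 (does (q ∣? k))

        u-yes : ∀ {k} → q ∣ k → u k ≈ 1#
        u-yes q∣k = reflexive (≡.cong 𝟙 (dec-true (q ∣? _) q∣k))

        u-no : ∀ {k} → q ∤ k → u k ≈ 0#
        u-no q∤k = reflexive (≡.cong 𝟙 (dec-false (q ∣? _) q∤k))

        u-+q : ∀ k → u (q ℕ.+ k) ≈ u k
        u-+q k = case q ∣? k of λ where
          (yes q∣k) → trans (u-yes (ℕ.∣m∣n⇒∣m+n ℕ.∣-refl q∣k)) (sym (u-yes q∣k))
          (no  q∤k) → trans (u-no (λ q∣ → q∤k (ℕ.∣m+n∣m⇒∣n q∣ ℕ.∣-refl))) (sym (u-no q∤k))

        period : series u q ≈ 1#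
        period = trans (+-cong (u-yes (q ℕ.∣0)) (trans (*-congˡ (series-0 q′ λ k<q′ → u-no (ℕ.>⇒∤ (s≤s k<q′)))) (zeroʳ ω)))
                       (+-identityʳ 1#)

      -- The multiples of q up to m q contribute 1 + e + ⋯ + eᵐ with e = ω^q; this is the geometric
      -- sum for e without subtraction.
      series-multiples : ∀ m → series u (suc (m ℕ.* q)) + (ω ^ q) ^ suc m ≈ 1# + ω ^ q * series u (suc (m ℕ.* q))
      series-multiples zero = +-cong S≈1 (*-congˡ (sym S≈1))
        where
        S≈1 : series u 1 ≈ 1#
        S≈1 = trans (+-cong (u-yes (q ℕ.∣0)) (zeroʳ ω)) (+-identityʳ 1#)
      series-multiples (suc m) = begin
        series u (suc (q ℕ.+ m ℕ.* q)) + e * e ^ suc m   ≈⟨ +-congʳ unfold ⟩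
        1# + e * s + e * e ^ suc m                       ≈⟨ solve 3 (λ e s t → con 1 :+ e :* s :+ e :* t := con 1 :+ e :* (s :+ t)) refl e s (e ^ suc m) ⟩
        1# + e * (s + e ^ suc m)                         ≈⟨ +-congˡ (*-congˡ (series-multiples m)) ⟩
        1# + e * (1# + e * s)                            ≈⟨ +-congˡ (*-congˡ unfold) ⟨
        1# + e * series u (suc (q ℕ.+ m ℕ.* q))          ∎
        where
        e = ω ^ q
        s = series u (suc (m ℕ.* q))
        unfold : series u (suc (q ℕ.+ m ℕ.* q)) ≈ 1# + e * s
        -- The first period contributes only its term at 0; the rest is the same series shifted by
        -- q.
        unfold = begin
          series u (suc (q ℕ.+ m ℕ.* q))       ≡⟨ ≡.cong (series u) (ℕ.+-suc q (m ℕ.* q)) ⟨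
          series u (q ℕ.+ suc (m ℕ.* q))       ≈⟨ series-split u q (suc (m ℕ.* q)) ⟩
          series u q + e * series (λ k → u (q ℕ.+ k)) (suc (m ℕ.* q))
            ≈⟨ +-cong period (*-congˡ (series-cong (suc (m ℕ.* q)) λ {k} _ → u-+q k)) ⟩
          1# + e * s                           ∎

  -- (1 - x) y vanishes, and 1 - x can be cancelled.
  fixed-point⇒0 : NoZeroDivisors → ∀ {x y} → x ≉ 1# → y ≈ x * y → y ≈ 0#
  fixed-point⇒0 nzd {x} {y} x≉1 y≈xy = nzd (x≉1 ∘ sym ∘ x-y≈0⇒x≈y 1# x) (begin
    (1# - x) * y        ≈⟨ solve 2 (λ n y → (con 1 :+ n) :* y := y :+ n :* y) refl (- x) y ⟩
    y + - x * y         ≈⟨ +-cong y≈xy (sym (-‿distribˡ-* x y)) ⟩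
    x * y - x * y       ≈⟨ -‿inverseʳ (x * y) ⟩
    0#                  ∎)

  -- The semigroup polynomial and its roots.

  module SemigroupPolynomial (p′ q′ x : ℕ) (0<p′ : 0 ℕ.< p′) (p≤q′ : suc p′ ℕ.≤ q′)
                             (xq≡1 : (x ℕ.* suc q′) % suc p′ ≡ 1 % suc p′) where

    open Semigroup p′ q′ x p≤q′ xq≡1
    open SemigroupGaps p′ q′ x 0<p′ p≤q′ xq≡1

    private
      conductor = p′ ℕ.* q′

      s u : ℕ → Carrier
      s k = 𝟙 (does (k ∈S?))
      u k = 𝟙 (does (q ∣? k))

      𝟙-yes : ∀ {A : Set} (A? : Dec A) → A → 𝟙 (does A?) ≈ 1#
      𝟙-yes A? a = reflexive (≡.cong 𝟙 (dec-true A? a))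

      𝟙-no : ∀ {A : Set} (A? : Dec A) → ¬ A → 𝟙 (does A?) ≈ 0#
      𝟙-no A? ¬a = reflexive (≡.cong 𝟙 (dec-false A? ¬a))

      -- The equation allows matching on `k` to reach the predecessor c - 1.
      pred∈S-conductor : ∀ {k} → k ≡ conductor → pred∈S k ≡ false
      pred∈S-conductor {zero}  _   = ≡.refl
      pred∈S-conductor {suc d} d≡c = dec-false (d ∈S?) (conductor∸1∉S d≡c)

      -- Below p both indicators are supported at 0 alone.
      s≈u : ∀ {k} → k ℕ.< p → s k ≈ u k
      s≈u {zero}  _   = trans (𝟙-yes (0 ∈S?) 0∈S) (sym (𝟙-yes (q ∣? 0) (q ℕ.∣0)))
      s≈u {suc k} k<p = trans (𝟙-no (suc k ∈S?) (∉S-<p z<s k<p))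
        (sym (𝟙-no (q ∣? suc k) (ℕ.>⇒∤ (ℕ.<-trans k<p (s≤s p≤q′)))))

      -- The coefficient form of (1 - Xᵖ) Σ Xˢ = Σ X^(jq): k + p is in S either through k or as a
      -- multiple of q, never both. The bound on k gives k + p ≤ p′ q, so such multiples have j < p.
      s-+p : ∀ {k} → k ℕ.< conductor → s (p ℕ.+ k) ≈ s k + u (p ℕ.+ k)
      s-+p {k} k<c = ≡.subst (λ m → s m ≈ s k + u m) (ℕ.+-comm k p) (case k ∈S? of λ where
          (yes k∈) → begin
            s (k ℕ.+ p)        ≈⟨ 𝟙-yes (k ℕ.+ p ∈S?) (∈S-+p k∈) ⟩
            1#                 ≈⟨ +-identityʳ 1# ⟨
            1# + 0#            ≈⟨ +-cong (𝟙-yes (k ∈S?) k∈) (𝟙-no (q ∣? k ℕ.+ p) (∈S⇒+p∤ k+p≤ k∈)) ⟨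
            s k + u (k ℕ.+ p)  ∎
          (no k∉) → begin
            s (k ℕ.+ p)        ≈⟨ s≈u′ k∉ ⟩
            u (k ℕ.+ p)        ≈⟨ +-identityˡ _ ⟨
            0# + u (k ℕ.+ p)   ≈⟨ +-congʳ (𝟙-no (k ∈S?) k∉) ⟨
            s k + u (k ℕ.+ p)  ∎)
        where
        k+p≤ : k ℕ.+ p ℕ.≤ p′ ℕ.* q
        k+p≤ = ℕ.s≤s⁻¹ (≡.subst (suc (k ℕ.+ p) ℕ.≤_) p′q′+p≡1+p′q (ℕ.+-monoˡ-≤ p k<c))

        s≈u′ : ¬ k ∈S → s (k ℕ.+ p) ≈ u (k ℕ.+ p)
        s≈u′ k∉ = case q ∣? k ℕ.+ p of λ where
          (yes q∣) → trans (𝟙-yes (k ℕ.+ p ∈S?) (multiple⇒∈S k+p≤ q∣)) (sym (𝟙-yes (q ∣? k ℕ.+ p) q∣))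
          (no  q∤) → trans (𝟙-no (k ℕ.+ p ∈S?) (λ k+p∈ → case ∈S-step k+p∈ of λ where
              (inj₁ k∈) → k∉ k∈
              (inj₂ q∣) → q∤ q∣))
            (sym (𝟙-no (q ∣? k ℕ.+ p) q∤))

    semigroupPolynomial : Polynomial
    semigroupPolynomial = applyUpTo (difference pred∈S) (suc conductor)

    semigroupPolynomial-monic : Monic conductor semigroupPolynomial
    semigroupPolynomial-monic = applyUpTo-monic (difference pred∈S) conductor (begin
      s conductor - 𝟙 (pred∈S conductor)
        ≈⟨ +-cong (𝟙-yes (conductor ∈S?) (conductor≤⇒∈S ℕ.≤-refl))
                  (-‿cong (reflexive (≡.cong 𝟙 (pred∈S-conductor ≡.refl)))) ⟩
      1# - 0#   ≈⟨ +-congˡ -0#≈0# ⟩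
      1# + 0#   ≈⟨ +-identityʳ 1# ⟩
      1#        ∎)

    -- Formally (1 - ωᵖ) F(ω) = (1 - ω)(1 + ω^q + ⋯ + ω^(p′q)), whose last factor vanishes. With
    -- sums truncated at N, the identities `E+ωT` and `ωᵖT` yield F(ω) = ωᵖ F(ω).
    semigroupPolynomial-root : NoZeroDivisors → ∀ {ω} → ω ^ p ≉ 1# → ω ^ q ≉ 1# → (ω ^ q) ^ p ≈ 1# →
                               eval semigroupPolynomial ω ≈ 0#
    semigroupPolynomial-root nzd {ω} ωᵖ≉1 ω^q≉1 ωᵖ^q≈1 =
      -- The quantity ω (T + ω^N Q), equal to ω ωᵖ T, is added to both sides and cancelled, which
      -- avoids subtraction.
      fixed-point⇒0 nzd ωᵖ≉1 (+-cancelʳ (ω * (T + ω ^ N * Q)) E (ω ^ p * E) (begin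
        E + ω * (T + ω ^ N * Q)
          ≈⟨ solve 5 (λ e w t d k → e :+ w :* (t :+ d :* k) := e :+ w :* t :+ w :* d :* k) refl E ω T (ω ^ N) Q ⟩
        E + ω * T + ω * ω ^ N * Q
          ≈⟨ +-congʳ E+ωT ⟩
        T + ω ^ N + ω * ω ^ N * Q
          ≈⟨ solve 4 (λ w t d k → t :+ d :+ w :* d :* k := t :+ d :* (con 1 :+ w :* k)) refl ω T (ω ^ N) Q ⟩
        T + ω ^ N * (1# + ω * Q)
          ≈⟨ +-congˡ (*-congˡ (series-1 ω p)) ⟨
        T + ω ^ N * (Q + ω ^ p)
          ≈⟨ solve 4 (λ t d k v → t :+ d :* (k :+ v) := t :+ d :* k :+ v :* d) refl T (ω ^ N) Q (ω ^ p) ⟩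
        T + ω ^ N * Q + ω ^ p * ω ^ N
          ≈⟨ +-congʳ ωᵖT ⟩
        ω ^ p * T + ω ^ p * ω ^ N
          ≈⟨ distribˡ (ω ^ p) T (ω ^ N) ⟨
        ω ^ p * (T + ω ^ N)
          ≈⟨ *-congˡ E+ωT ⟨
        ω ^ p * (E + ω * T)
          ≈⟨ solve 4 (λ v e w t → v :* (e :+ w :* t) := v :* e :+ w :* (v :* t)) refl (ω ^ p) E ω T ⟩
        ω ^ p * E + ω * (ω ^ p * T)
          ≈⟨ +-congˡ (*-congˡ ωᵖT) ⟨
        ω ^ p * E + ω * (T + ω ^ N * Q) ∎))
      where
      N = conductor
      T = series ω s N
      E = eval semigroupPolynomial ω
      Q = series ω (λ _ → 1#) p
      G = series ω u (suc (p′ ℕ.* q))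

      -- summation by parts
      E+ωT : E + ω * T ≈ T + ω ^ N
      E+ωT = begin
        E + ω * T
          -- The series of `pred∈S` unfolds to 0 + ω T, since `pred∈S` is false at 0 and shifts S by
          -- one.
          ≈⟨ +-congˡ (+-identityˡ (ω * T)) ⟨
        E + series ω (𝟙 ∘ pred∈S) (suc N)
          ≈⟨ series-+ ω (difference pred∈S) (𝟙 ∘ pred∈S) (suc N) ⟨
        series ω (λ k → difference pred∈S k + 𝟙 (pred∈S k)) (suc N)
          ≈⟨ series-cong ω (suc N) (λ {k} _ → difference-+ k) ⟩
        series ω s (suc N)
          ≡⟨ ≡.cong (series ω s) (ℕ.+-comm 1 N) ⟩
        series ω s (N ℕ.+ 1)
          ≈⟨ series-split ω s N 1 ⟩
        T + ω ^ N * (s (N ℕ.+ 0) + ω * 0#)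
          ≈⟨ +-congˡ (*-congˡ (+-cong (𝟙-yes (N ℕ.+ 0 ∈S?) (conductor≤⇒∈S (ℕ.m≤m+n N 0))) (zeroʳ ω))) ⟩
        T + ω ^ N * (1# + 0#)
          ≈⟨ solve 2 (λ t w → t :+ w :* (con 1 :+ con 0) := t :+ w) refl T (ω ^ N) ⟩
        T + ω ^ N ∎
        where
        difference-+ : ∀ k → difference pred∈S k + 𝟙 (pred∈S k) ≈ s k
        difference-+ k = trans (+-assoc (s k) _ _) (trans (+-congˡ (-‿inverseˡ _)) (+-identityʳ (s k)))

      -- G is the geometric sum of the p powers of e = ω^q, so eᵖ = 1 turns its identity into G = e
      -- G.
      G≈0 : G ≈ 0#
      G≈0 = fixed-point⇒0 nzd ω^q≉1 (+-cancelʳ 1# G (ω ^ q * G) (begin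
        G + 1#               ≈⟨ +-congˡ ωᵖ^q≈1 ⟨
        G + (ω ^ q) ^ p      ≈⟨ series-multiples ω q′ p′ ⟩
        1# + ω ^ q * G       ≈⟨ +-comm 1# _ ⟩
        ω ^ q * G + 1#       ∎))

      -- The series of S up to N + p = 1 + p′ q is split twice: at N, where the tail is all ones,
      -- and at p, where the shift law leaves ωᵖ T plus the multiples of q, summing to G.
      ωᵖT : T + ω ^ N * Q ≈ ω ^ p * T
      ωᵖT = begin
        T + ω ^ N * Q
          ≈⟨ +-congˡ (*-congˡ (series-cong ω p λ {k} _ → 𝟙-yes (N ℕ.+ k ∈S?) (conductor≤⇒∈S (ℕ.m≤m+n N k)))) ⟨
        T + ω ^ N * series ω (λ k → s (N ℕ.+ k)) p
          ≈⟨ series-split ω s N p ⟨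
        series ω s (N ℕ.+ p)
          ≡⟨ ≡.cong (series ω s) (ℕ.+-comm N p) ⟩
        series ω s (p ℕ.+ N)
          ≈⟨ series-split ω s p N ⟩
        series ω s p + ω ^ p * series ω (λ k → s (p ℕ.+ k)) N
          ≈⟨ +-cong (series-cong ω p s≈u) (*-congˡ (trans (series-cong ω N s-+p)
               (series-+ ω s (λ k → u (p ℕ.+ k)) N))) ⟩
        series ω u p + ω ^ p * (T + series ω (λ k → u (p ℕ.+ k)) N)
          ≈⟨ solve 4 (λ a w t b → a :+ w :* (t :+ b) := a :+ w :* b :+ w :* t) refl
               (series ω u p) (ω ^ p) T (series ω (λ k → u (p ℕ.+ k)) N) ⟩
        series ω u p + ω ^ p * series ω (λ k → u (p ℕ.+ k)) N + ω ^ p * T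
          ≈⟨ +-congʳ (series-split ω u p N) ⟨
        series ω u (p ℕ.+ N) + ω ^ p * T
          ≡⟨ ≡.cong (λ n → series ω u n + ω ^ p * T) (≡.trans (ℕ.+-comm p N) p′q′+p≡1+p′q) ⟩
        G + ω ^ p * T
          ≈⟨ trans (+-congʳ G≈0) (+-identityˡ _) ⟩
        ω ^ p * T ∎

  -- Powers of a primitive root of unity.

  module RootsOfUnity {n} .{{_ : ℕ.NonZero n}} {ζ} (ζ-primitive : IsPrimitiveRootOfUnity R n ζ) where

    ζⁿ≈1 : ζ ^ n ≈ 1#
    ζⁿ≈1 = proj₁ ζ-primitive

    1^ : ∀ k → 1# ^ k ≈ 1#
    1^ zero    = refl
    1^ (suc k) = trans (*-identityˡ _) (1^ k)

    ^-multiple : ∀ {m} → n ∣ m → ζ ^ m ≈ 1#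
    ^-multiple (divides k ≡.refl) = begin
      ζ ^ (k ℕ.* n)    ≡⟨ ≡.cong (ζ ^_) (ℕ.*-comm k n) ⟩
      ζ ^ (n ℕ.* k)    ≈⟨ ^-assocʳ ζ n k ⟨
      (ζ ^ n) ^ k      ≈⟨ ^-congˡ k ζⁿ≈1 ⟩
      1# ^ k           ≈⟨ 1^ k ⟩
      1#               ∎

    -- The remainder r of m modulo n also satisfies ζʳ = 1, and primitivity excludes 0 < r < n.
    order-∣ : ∀ {m} → ζ ^ m ≈ 1# → n ∣ m
    order-∣ {m} ζᵐ≈1 with m % n in eq
    ... | zero  = ℕ.m%n≡0⇒n∣m m n eq
    ... | suc r = contradiction (begin
      ζ ^ suc r                          ≈⟨ *-identityʳ _ ⟨
      ζ ^ suc r * 1#                     ≈⟨ *-congˡ (^-multiple (ℕ.n∣m*n (m / n))) ⟨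
      ζ ^ suc r * ζ ^ (m / n ℕ.* n)      ≈⟨ ^-homo-* ζ (suc r) (m / n ℕ.* n) ⟨
      ζ ^ (suc r ℕ.+ m / n ℕ.* n)        ≡⟨ ≡.cong (λ r → ζ ^ (r ℕ.+ m / n ℕ.* n)) eq ⟨
      ζ ^ (m % n ℕ.+ m / n ℕ.* n)        ≡⟨ ≡.cong (ζ ^_) (m≡m%n+[m/n]*n m n) ⟨
      ζ ^ m                              ≈⟨ ζᵐ≈1 ⟩
      1#                                 ∎)
      (proj₂ ζ-primitive (suc r) z<s (≡.subst (ℕ._< n) eq (m%n<n m n)))

    -- Multiplying by ζ^(n - i), the inverse of ζⁱ, would give ζ^(j - i) = 1 with 0 < j - i < n.
    powers-distinct : ∀ {i j} → i ℕ.< j → j ℕ.≤ n → 0 ℕ.< i → ζ ^ i ≉ ζ ^ j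
    powers-distinct {i} {j} i<j j≤n 0<i ζⁱ≈ζʲ =
      proj₂ ζ-primitive (j ℕ.∸ i) (ℕ.m<n⇒0<n∸m i<j) (ℕ.<-≤-trans (ℕ.∸-monoʳ-< 0<i i≤j) j≤n) (begin
        ζ ^ (j ℕ.∸ i)                      ≈⟨ *-identityʳ _ ⟨
        ζ ^ (j ℕ.∸ i) * 1#                 ≈⟨ *-congˡ ζⁱ*≈1 ⟨
        ζ ^ (j ℕ.∸ i) * (ζ ^ i * ζ ^ (n ℕ.∸ i))   ≈⟨ *-assoc _ _ _ ⟨
        ζ ^ (j ℕ.∸ i) * ζ ^ i * ζ ^ (n ℕ.∸ i)     ≈⟨ *-congʳ (^-homo-* ζ (j ℕ.∸ i) i) ⟨
        ζ ^ (j ℕ.∸ i ℕ.+ i) * ζ ^ (n ℕ.∸ i)       ≡⟨ ≡.cong (λ k → ζ ^ k * ζ ^ (n ℕ.∸ i)) (ℕ.m∸n+n≡m i≤j) ⟩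
        ζ ^ j * ζ ^ (n ℕ.∸ i)              ≈⟨ *-congʳ ζⁱ≈ζʲ ⟨
        ζ ^ i * ζ ^ (n ℕ.∸ i)              ≈⟨ ζⁱ*≈1 ⟩
        1#                                 ∎)
      where
      i≤j = ℕ.<⇒≤ i<j
      ζⁱ*≈1 : ζ ^ i * ζ ^ (n ℕ.∸ i) ≈ 1#
      ζⁱ*≈1 = begin
        ζ ^ i * ζ ^ (n ℕ.∸ i)   ≈⟨ ^-homo-* ζ i (n ℕ.∸ i) ⟨
        ζ ^ (i ℕ.+ (n ℕ.∸ i))   ≡⟨ ≡.cong (ζ ^_) (ℕ.m+[n∸m]≡n (ℕ.≤-trans i≤j j≤n)) ⟩
        ζ ^ n                   ≈⟨ ζⁿ≈1 ⟩
        1#                      ∎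

  -- Identification of Φ with the semigroup polynomial.

  cyclotomic-maximumGap : NoZeroDivisors → 1# ≉ 0# → ∀ {p′ q′} → Prime (suc p′) → Prime (suc q′) → p′ ℕ.< q′ →
                          ∀ {ζ} → IsPrimitiveRootOfUnity R (suc p′ ℕ.* suc q′) ζ →
                          HasMaximumGap R (cyclotomic R (suc p′ ℕ.* suc q′) ζ) p′
  cyclotomic-maximumGap nzd 1≉0 {p′} {q′} p-prime q-prime p′<q′ {ζ} ζ-primitive =
    terms pred∈S len , terms≢[] , terms-isSparseForm pred∈S 1≉0 len cyclotomic≈ , gap≡p′
    where
    p = suc p′
    q = suc q′
    n = p ℕ.* q
    len = suc (p′ ℕ.* q′)

    0<p′ : 0 ℕ.< p′
    0<p′ = ℕ.s<s⁻¹ (ℕ.nonTrivial⇒n>1 p {{prime⇒nonTrivial p-prime}})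

    q⁻¹ : ∃[ x ] (x ℕ.* q) % p ≡ 1 % p
    q⁻¹ = coprime⇒invertible (primes-coprime p-prime q-prime (s≤s p′<q′))

    open SemigroupGaps p′ q′ (proj₁ q⁻¹) 0<p′ p′<q′ (proj₂ q⁻¹)
    open SemigroupPolynomial p′ q′ (proj₁ q⁻¹) 0<p′ p′<q′ (proj₂ q⁻¹)
    open RootsOfUnity {n} ζ-primitive

    gap≡p′ : largestGap (map proj₂ (terms pred∈S len)) ≡ p′
    gap≡p′ = ≡.trans (≡.cong largestGap (exponents-terms pred∈S len)) largestGap-changes

    terms≢[] : terms pred∈S len ≢ []
    -- An empty list would have largest gap 0, but the gap is p′ > 0.
    terms≢[] eq = ℕ.<⇒≢ 0<p′ (≡.trans (≡.sym (≡.cong (largestGap ∘ map proj₂) eq)) gap≡p′)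

    roots : List Carrier
    roots = map (ζ ^_) (totatives R n)

    length-roots : length roots ≡ p′ ℕ.* q′
    length-roots = ≡.trans (length-map (ζ ^_) (totatives R n)) (count-totatives p-prime q-prime p′<q′)

    roots-distinct : AllPairs _≉_ roots
    roots-distinct = AllPairs.map⁺ (AllPairs.filter⁺ (totative? n)
      (AllPairs.applyUpTo⁺₁ suc n λ i<j j<n → powers-distinct (s≤s i<j) j<n z<s))

    totative-root : ∀ j → Totative n j → eval semigroupPolynomial (ζ ^ j) ≈ 0#
    totative-root j tot = semigroupPolynomial-root nzd
      -- If (ζʲ)ᵖ = 1, then p q divides j p, so q divides j; the next argument exchanges p and q.
      (λ eq → q∤j (ℕ.*-cancelʳ-∣ p (≡.subst (_∣ j ℕ.* p) (ℕ.*-comm p q)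
        (order-∣ (trans (sym (^-assocʳ ζ j p)) eq)))))
      (λ eq → p∤j (ℕ.*-cancelʳ-∣ q (order-∣ (trans (sym (^-assocʳ ζ j q)) eq))))
      (trans (trans (^-congˡ p (^-assocʳ ζ j q)) (^-assocʳ ζ (j ℕ.* q) p)) (^-multiple n∣jqp))
      where
      p∤j = proj₁ (totative⇒∤ p-prime q-prime (s≤s p′<q′) {j} tot)
      q∤j = proj₂ (totative⇒∤ p-prime q-prime (s≤s p′<q′) {j} tot)
      n∣jqp : n ∣ j ℕ.* q ℕ.* p
      n∣jqp = divides j (≡.trans (ℕ.*-assoc j q p) (≡.cong (j ℕ.*_) (ℕ.*-comm q p)))

    cyclotomic≈ : cyclotomic R n ζ ≋ semigroupPolynomial
    cyclotomic≈ k = trans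
      (reflexive (≡.cong (λ fs → coef (productₚ R fs) k) (map-∘ (totatives R n))))
      (product-of-roots nzd roots
        -- The degree (p - 1)(q - 1) equals the number φ(p q) of roots.
        (≡.subst (λ d → Monic d semigroupPolynomial) (≡.sym length-roots) semigroupPolynomial-monic)
        roots-distinct
        (All.map⁺ (All.map (λ {j} → totative-root j) (All.all-filter (totative? n) (applyUpTo suc n)))) k)

-- Cancellation in Heyting fields.

module _ {c ℓ₁ ℓ₂} (K : HeytingField c ℓ₁ ℓ₂) where

  open HeytingField K
  open CommutativeRing (fieldRing K) using (_≉_)
  open import Algebra.Apartness.Properties.HeytingCommutativeRing heytingCommutativeRing using (1#0; x-0≈x)
  open import Relation.Binary.Reasoning.Setoid setoid

  1≉0 : 1# ≉ 0#
  1≉0 1≈0 = proj₂ (tight 1# 0#) 1≈0 1#0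

  -- By tightness it suffices to refute y # 0, which would make y invertible and hence x zero.
  noZeroDivisors : Polynomials.NoZeroDivisors (fieldRing K)
  noZeroDivisors {x} {y} x≉0 xy≈0 = proj₁ (tight y 0#) λ y#0 →
    let y⁻¹ , _ , yy⁻¹≈1 = #⇒invertible y#0 in
    x≉0 (begin
      x                        ≈⟨ *-identityʳ x ⟨
      x * 1#                   ≈⟨ *-congˡ yy⁻¹≈1 ⟨
      x * ((y + - 0#) * y⁻¹)   ≈⟨ *-congˡ (*-congʳ (x-0≈x y)) ⟩
      x * (y * y⁻¹)            ≈⟨ *-assoc x y y⁻¹ ⟨
      x * y * y⁻¹              ≈⟨ *-congʳ xy≈0 ⟩
      0# * y⁻¹                 ≈⟨ zeroˡ y⁻¹ ⟩
      0#                       ∎)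

open import Data.Nat using (ℕ; _*_; _∸_; _<_; s≤s⁻¹)

theorem1 : ∀ {c ℓ₁ ℓ₂} (K : HeytingField c ℓ₁ ℓ₂) → CharacteristicZero (fieldRing K) →
    (p₁ p₂ : ℕ) → Prime p₁ → Prime p₂ → 2 ∤ p₁ → 2 ∤ p₂ → p₁ < p₂ →
    (ζ : HeytingField.Carrier K) → IsPrimitiveRootOfUnity (fieldRing K) (p₁ * p₂) ζ →
    HasMaximumGap (fieldRing K) (cyclotomic (fieldRing K) (p₁ * p₂) ζ) (p₁ ∸ 1)
theorem1 K _ zero     _        ()
theorem1 K _ (suc p′) zero     _       ()
theorem1 K _ (suc p′) (suc q′) p-prime q-prime _ _ p<q ζ ζ-primitive =
  Polynomials.cyclotomic-maximumGap (fieldRing K) (noZeroDivisors K) (1≉0 K) p-prime q-prime (s≤s⁻¹ p<q) ζ-primitive
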